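{- Let $G$ be a graph and consider a play of width $w$ constructing $G$. The birth order of the play, i.e. any linear order of $V(G)$ in which vertices born in an earlier birth move precede vertices born in a later birth move, with the vertices within each birth group ordered arbitrarily, is a layout $\pi$ of $G$ of active neighborhood-width $\mathrm{anw}_\pi(G)\le\lfloor w/2\rfloor$.
   Context: All graphs are finite, simple and undirected. Active neighborhood-width of a layout. A layout of $G$ is a linear order $\pi=(v_1,\dots,v_n)$ of $V(G)$; put $P_i=\{v_1,\dots,v_i\}$ for $0\le i\le n$. For $u\in P_i$ let $r_i^\pi(u)=N_G(u)\cap (V(G)\setminus P_i)$. Let $\mathcal A_i^\pi=\{r_i^\pi(u):u\in P_i\}\setminus\{\emptyset\}$. Then $\mathrm{anw}_\pi(G)=\max_i|\mathcal A_i^\pi|$. Sequential cable plays. A configuration on $G$ consists of the set of born vertices, a family $\mathcal L$ of pairwise disjoint nonempty sets of born vertices (the live cables), and a set of already placed edges; initially all are empty. With $\ell=|\mathcal L|$ the number of live cables before a move, the moves are: (i) birth$(S)$: introduces a nonempty set $S$ of fresh (not yet born) vertices of $G$ as one live cable; cost $2\ell+1$. The set $S$ is called a birth group. (ii) fold$(X,Y)$: replaces two distinct live cables $X,Y$ by $X\cup Y$; cost $2\ell-1$. (iii) block$(X,Y)$: places every edge between two distinct live cables $X,Y$; legal when all these pairs are edges of $G$ and at least one has not already been placed; cost $2\ell$. (iv) clique$(X)$: places every edge inside a live cable $X$; legal when $X$ is a clique of $G$ and at least one internal edge has not already been placed; cost $2\ell$. (v) close$(X)$: removes the live cable $X$;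 legal when every edge of $G$ incident with a vertex of $X$ has already been placed; cost $2\ell-1$. A play (a finite sequence of legal moves from the initial configuration) constructs $G$ if every vertex is born, every edge of $G$ is placed, and every cable is closed. The width of a play is the maximum cost of its moves (and $0$ for the empty play on the empty graph). -}

module Defs where

open import Data.Bool using () renaming (_≟_ to _≟ᵇ_)
open import Data.Empty using (⊥-elim)
open import Data.Fin using (Fin; toℕ; _<_)
open import Data.Fin.Permutation using (Permutation′; _⟨$⟩ˡ_)
open import Data.Fin.Subset using (Subset; _∈_; _∉_; _⊆_; _∩_; _∪_; ∁; ⊥; ⊤; Nonempty; Empty)
open import Data.Fin.Subset.Properties using (_∈?_; nonempty?; ∉⊥)
open import Data.List using (List; []; _∷_; allFin; deduplicate; filter; foldr; length; map)
import Data.List.Membership.Propositional as List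
open import Data.List.Relation.Binary.Permutation.Propositional using (_↭_)
open import Data.List.Relation.Unary.All using (All; [])
open import Data.List.Relation.Unary.AllPairs using (AllPairs; [])
open import Data.Nat using (ℕ; suc; _+_; _*_; _∸_; _⊔_; _<?_)
open import Data.Product using (_×_; ∃; ∃₂)
open import Data.Sum using (_⊎_)
open import Data.Vec using (tabulate)
open import Data.Vec.Properties using (≡-dec)
open import Function using (_⇔_)
open import Relation.Binary.Construct.Closure.ReflexiveTransitive using (Star; ε; _◅_)
open import Relation.Binary.PropositionalEquality using (_≡_; _≢_)
open import Relation.Nullary using (does)

------------------------------------------------------------------------
-- Graphs and layouts

record Graph (n : ℕ) : Set where
  field
    N      : Fin n → Subset n
    sym    : ∀ {u v} → v ∈ N u → u ∈ N v
    irrefl : ∀ {u} → u ∉ N u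

-- For a layout π = (v₁, …, vₙ), π ⟨$⟩ˡ u is the 0-based position of u.
Layout : ℕ → Set
Layout n = Permutation′ n

maximum : List ℕ → ℕ
maximum = foldr _⊔_ 0

module _ {n : ℕ} (G : Graph n) (π : Layout n) where
  open Graph G

  P : ℕ → Subset n
  P i = tabulate (λ u → does (toℕ (π ⟨$⟩ˡ u) <? i))

  r : ℕ → Fin n → Subset n
  r i u = N u ∩ ∁ (P i)

  -- Listed without repetition, so that its length is the cardinality of 𝒜ᵢ.
  𝒜 : ℕ → List (Subset n)
  𝒜 i = deduplicate (≡-dec _≟ᵇ_)
          (filter nonempty? (map (r i) (filter (_∈? P i) (allFin n))))

  anw : ℕ
  anw = maximum (map (λ (i : Fin (suc n)) → length (𝒜 (toℕ i))) (allFin (suc n)))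

------------------------------------------------------------------------
-- Cable plays

Disjoint : ∀ {n} → Subset n → Subset n → Set
Disjoint X Y = Empty (X ∩ Y)

-- The edge uv has been placed when v ∈ placed u. The list of live cables
-- represents a family of sets: its entries are nonempty and pairwise disjoint,
-- hence distinct, and the moves below only constrain it up to permutation.
record Config {n : ℕ} (G : Graph n) : Set where
  open Graph G
  field
    born          : Subset n
    live          : List (Subset n)
    live-disjoint : AllPairs Disjoint live
    live-nonempty : All Nonempty live
    live-born     : All (_⊆ born) live
    placed        : Fin n → Subset n
    placed-sym    : ∀ {u v} → v ∈ placed u → u ∈ placed v
    placed-edges  : ∀ u → placed u ⊆ N u

module _ {n : ℕ} {G : Graph n} where
  open Graph G
  open Config

  initial : Config G
  initial = record
    { born          = ⊥
    ; live          = []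
    ; live-disjoint = []
    ; live-nonempty = []
    ; live-born     = []
    ; placed        = λ _ → ⊥
    ; placed-sym    = λ v∈⊥ → ⊥-elim (∉⊥ v∈⊥)
    ; placed-edges  = λ _ v∈⊥ → ⊥-elim (∉⊥ v∈⊥)
    }

  SamePlaced : Config G → Config G → Set
  SamePlaced c c′ = ∀ u → placed c′ u ≡ placed c u

  Places : (Fin n → Fin n → Set) → Config G → Config G → Set
  Places E c c′ = ∀ u v → v ∈ placed c′ u ⇔ (v ∈ placed c u ⊎ E u v)

  Between : Subset n → Subset n → Fin n → Fin n → Set
  Between X Y u v = (u ∈ X × v ∈ Y) ⊎ (u ∈ Y × v ∈ X)

  Inside : Subset n → Fin n → Fin n → Set
  Inside X u v = u ∈ X × v ∈ X × u ≢ v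

  -- A Move c c′ is a legal move from c to c′. In fold, X and Y are distinct
  -- because they are separate entries of the repetition-free list live c.
  data Move (c c′ : Config G) : Set where

    birth : ∀ S →
            Nonempty S → Disjoint S (born c) →
            born c′ ≡ S ∪ born c →
            live c′ ↭ S ∷ live c →
            SamePlaced c c′ →
            Move c c′

    fold : ∀ X Y rest →
           live c ↭ X ∷ Y ∷ rest →
           born c′ ≡ born c →
           live c′ ↭ (X ∪ Y) ∷ rest →
           SamePlaced c c′ →
           Move c c′

    block : ∀ X Y →
            X List.∈ live c → Y List.∈ live c → X ≢ Y →
            (∀ {u v} → u ∈ X → v ∈ Y → v ∈ N u) →
            (∃₂ λ u v → u ∈ X × v ∈ Y × v ∉ placed c u) →
            born c′ ≡ born c →
            live c′ ↭ live c →
            Places (Between X Y) c c′ →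
            Move c c′

    clique : ∀ X →
             X List.∈ live c →
             (∀ {u v} → u ∈ X → v ∈ X → u ≢ v → v ∈ N u) →
             (∃₂ λ u v → Inside X u v × v ∉ placed c u) →
             born c′ ≡ born c →
             live c′ ↭ live c →
             Places (Inside X) c c′ →
             Move c c′

    close : ∀ X rest →
            live c ↭ X ∷ rest →
            (∀ {u} → u ∈ X → N u ⊆ placed c u) →
            born c′ ≡ born c →
            live c′ ↭ rest →
            SamePlaced c c′ →
            Move c c′

  -- fold and close need a live cable, so the truncated subtraction is exact.
  cost : ∀ {c c′} → Move c c′ → ℕ
  cost {c} (birth _ _ _ _ _ _)            = 2 * length (live c) + 1
  cost {c} (fold _ _ _ _ _ _ _)           = 2 * length (live c) ∸ 1
  cost {c} (block _ _ _ _ _ _ _ _ _ _)    = 2 * length (live c)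
  cost {c} (clique _ _ _ _ _ _ _)         = 2 * length (live c)
  cost {c} (close _ _ _ _ _ _ _)          = 2 * length (live c) ∸ 1

  costs : ∀ {c d} → Star Move c d → List ℕ
  costs ε        = []
  costs (m ◅ ms) = cost m ∷ costs ms

  -- In chronological order.
  birthGroups : ∀ {c d} → Star Move c d → List (Subset n)
  birthGroups ε                          = []
  birthGroups (birth S _ _ _ _ _ ◅ ms)   = S ∷ birthGroups ms
  birthGroups (_ ◅ ms)                   = birthGroups ms

record Play {n : ℕ} (G : Graph n) : Set where
  field
    final : Config G
    moves : Star Move initial final

module _ {n : ℕ} {G : Graph n} (p : Play G) where
  open Graph G
  open Play p
  open Config final

  width : ℕ
  width = maximum (costs moves)

  record Constructs : Set where
    field
      all-born   : born ≡ ⊤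
      all-placed : ∀ u → N u ⊆ placed u
      all-closed : live ≡ []

  IsBirthOrder : Layout n → Set
  IsBirthOrder π = AllPairs Precedes (birthGroups moves)
    where
    Precedes : Subset n → Subset n → Set
    Precedes S T = ∀ {u v} → u ∈ S → v ∈ T → (π ⟨$⟩ˡ u) < (π ⟨$⟩ˡ v)

-- Fix a cut Pᵢ and consider the first move after which some edge leaving Pᵢ is
-- placed. It is a block or a clique, so it costs 2ℓ, where ℓ is the number of
-- live cables just before it. Both ends of the edge are born by then, hence so
-- is all of Pᵢ. Vertices of one cable stay together until that cable is closed,
-- and a block or clique reaching one of them reaches them all, so two vertices
-- of Pᵢ on the same cable have the same neighbours outside Pᵢ; vertices on a
-- closed cable have none there. Thus |𝒜ᵢ| ≤ ℓ.

{-# OPTIONS --safe #-}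
module Submission where

open import Defs
open import Data.Bool using () renaming (_≟_ to _≟ᵇ_)
open import Data.Empty using (⊥-elim)
open import Data.Fin using (Fin; toℕ)
import Data.Fin as Fin
open import Data.Fin.Permutation using (_⟨$⟩ˡ_)
open import Data.Fin.Properties using (any?; injective⇒≤)
open import Data.Fin.Subset using (Subset; _∈_; _∉_; _⊆_; _∪_; ∁; ⊥; ⊤; Nonempty)
open import Data.Fin.Subset.Properties
  using (_∈?_; ∉⊥; ∈⊤; nonempty?; ⊆-antisym; x∈p∩q⁺; x∈p∩q⁻; x∈p∪q⁺; x∈p∪q⁻; x∈∁p⇒x∉p)
open import Data.List using (List; []; _∷_; length; lookup; map; filter; allFin)
import Data.List.Membership.Propositional as List
open import Data.List.Membership.Propositional.Properties
  using (∈-lookup; ∈-deduplicate⁻; ∈-filter⁻; ∈-map⁻)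
open import Data.List.Properties using (foldr-preservesᵇ)
open import Data.List.Relation.Binary.Permutation.Propositional using (↭-sym)
open import Data.List.Relation.Binary.Permutation.Propositional.Properties using (Any-resp-↭)
open import Data.List.Relation.Unary.All as All using (All; []; _∷_)
import Data.List.Relation.Unary.All.Properties as All
open import Data.List.Relation.Unary.AllPairs using (AllPairs; []; _∷_)
open import Data.List.Relation.Unary.Any as Any using (Any; here; there)
import Data.List.Relation.Unary.Any.Properties as Any
open import Data.List.Relation.Unary.Unique.Propositional using (Unique)
open import Data.List.Relation.Unary.Unique.DecPropositional.Properties using (deduplicate-!)
open import Data.Nat using (ℕ; _≤_; _<_; _<?_; _+_; _*_; ⌊_/2⌋; z≤n)
open import Data.Nat.Properties
  using (≤-trans; ≤-reflexive; <-trans; m≤m⊔n; m≤n⊔m; ⊔-lub; ⌊n/2⌋-mono; n≡⌊n+n/2⌋; +-identityʳ)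
open import Data.Product using (_×_; _,_; ∃; proj₂)
open import Data.Sum using (_⊎_; inj₁; inj₂; [_,_]′)
open import Data.Vec.Properties using (≡-dec; lookup∘tabulate; []=⇒lookup; lookup⇒[]=)
open import Function using (_∘_; Equivalence)
open import Relation.Binary.Construct.Closure.ReflexiveTransitive using (Star; ε; _◅_)
open import Relation.Binary.PropositionalEquality
  using (_≡_; _≢_; refl; sym; trans; cong; subst)
open import Relation.Nullary using (¬_; Reflects; invert; yes; no; does; proof; contradiction)
open import Relation.Nullary.Decidable using (dec-true; decidable-stable; ¬?; _×-dec_)

-- Counting in finite lists.

lookup-injective : ∀ {a} {A : Set a} {xs : List A} → Unique xs →
                   ∀ {i j} → lookup xs i ≡ lookup xs j → i ≡ j
lookup-injective (_  ∷ _)   {Fin.zero}  {Fin.zero}  _  = refl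
lookup-injective (x∉ ∷ _)   {Fin.zero}  {Fin.suc j} eq = contradiction eq (All.lookup x∉ (∈-lookup j))
lookup-injective (x∉ ∷ _)   {Fin.suc i} {Fin.zero}  eq = contradiction (sym eq) (All.lookup x∉ (∈-lookup i))
lookup-injective (_  ∷ xs!) {Fin.suc i} {Fin.suc j} eq = cong Fin.suc (lookup-injective xs! eq)

-- Pigeonhole on positions: each entry of `xs` goes to the index of a related entry of `ys`. Two
-- positions with the same index carry equal entries by the last hypothesis, and uniqueness of `xs`
-- makes the positions equal.
Unique⇒length≤ : ∀ {a b r} {A : Set a} {B : Set b} (R : A → B → Set r) {xs : List A} {ys : List B} →
                 Unique xs →
                 (∀ {x} → x List.∈ xs → Any (R x) ys) →
                 (∀ {x x′ y} → R x y → R x′ y → x ≡ x′) →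
                 length xs ≤ length ys
Unique⇒length≤ R {xs} {ys} xs! cover R-inj = injective⇒≤ f-injective
  where
  hit : ∀ i → Any (R (lookup xs i)) ys
  hit i = cover (∈-lookup i)

  f : Fin (length xs) → Fin (length ys)
  f i = Any.index (hit i)

  f-injective : ∀ {i j} → f i ≡ f j → i ≡ j
  f-injective {i} {j} eq = lookup-injective xs!
    (R-inj (Any.lookup-index (hit i))
           (subst (R (lookup xs j) ∘ lookup ys) (sym eq) (Any.lookup-index (hit j))))

disjoint-unique : ∀ {n} {Xs : List (Subset n)} {X Y u} → AllPairs Disjoint Xs →
                  X List.∈ Xs → Y List.∈ Xs → u ∈ X → u ∈ Y → X ≡ Y
disjoint-unique _          (here refl) (here refl) _   _   = refl
disjoint-unique (X# ∷ _)   (here refl) (there Y∈)  u∈X u∈Y =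
  contradiction (_ , x∈p∩q⁺ (u∈X , u∈Y)) (All.lookup X# Y∈)
disjoint-unique (Y# ∷ _)   (there X∈)  (here refl) u∈X u∈Y =
  contradiction (_ , x∈p∩q⁺ (u∈Y , u∈X)) (All.lookup Y# X∈)
disjoint-unique (_ ∷ Xs#)  (there X∈)  (there Y∈)  u∈X u∈Y = disjoint-unique Xs# X∈ Y∈ u∈X u∈Y

maximum-lub : ∀ {k xs} → All (_≤ k) xs → maximum xs ≤ k
maximum-lub = foldr-preservesᵇ ⊔-lub z≤n

-- Precedence of vertex sets in a layout.

module _ {n : ℕ} (π : Layout n) where

  -- A copy of the relation local to `IsBirthOrder`; both unfold to the same type, so its proofs can
  -- be used here directly.
  Precedes : Subset n → Subset n → Set
  Precedes S T = ∀ {u v} → u ∈ S → v ∈ T → (π ⟨$⟩ˡ u) Fin.< (π ⟨$⟩ˡ v)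

  precedes-⊥ : ∀ T → Precedes ⊥ T
  precedes-⊥ _ u∈⊥ = ⊥-elim (∉⊥ u∈⊥)

  precedes-∪ : ∀ {S S′ Ts} → All (Precedes S) Ts → All (Precedes S′) Ts → All (Precedes (S ∪ S′)) Ts
  precedes-∪ [] [] = []
  precedes-∪ {S} {S′} (S<T ∷ S<Ts) (S′<T ∷ S′<Ts) =
    (λ u∈ v∈T → [ (λ u∈S → S<T u∈S v∈T) , (λ u∈S′ → S′<T u∈S′ v∈T) ]′ (x∈p∪q⁻ S S′ u∈))
    ∷ precedes-∪ S<Ts S′<Ts

-- Cables and placed edges along a play.

module _ {n : ℕ} {G : Graph n} where
  open Graph G hiding (sym)
  open Config

  -- The diagonal case `Together c u u` serves as the statement that `u` lies on a live cable.
  Together : Config G → Fin n → Fin n → Set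
  Together c u u′ = Any (λ X → u ∈ X × u′ ∈ X) (live c)

  Settled : Config G → Fin n → Set
  Settled c u = N u ⊆ placed c u

  together-∈ : ∀ (c : Config G) {u u′ X} → Together c u u′ → X List.∈ live c → u ∈ X → u′ ∈ X
  together-∈ c {u′ = u′} t X∈ u∈X with List.find t
  ... | _ , Y∈ , u∈Y , u′∈Y =
      subst (u′ ∈_) (disjoint-unique (live-disjoint c) Y∈ X∈ u∈Y u∈X) u′∈Y

  ∈live⇒∈born : ∀ (c : Config G) {X u} → X List.∈ live c → u ∈ X → u ∈ born c
  ∈live⇒∈born c X∈ u∈X = All.lookup (live-born c) X∈ u∈X

  placed-mono : ∀ {c c′ : Config G} → Move c c′ → ∀ {u} → placed c u ⊆ placed c′ u
  placed-mono (birth _ _ _ _ _ same)   {u} = subst (_ ∈_) (sym (same u))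
  placed-mono (fold _ _ _ _ _ _ same)  {u} = subst (_ ∈_) (sym (same u))
  placed-mono (close _ _ _ _ _ _ same) {u} = subst (_ ∈_) (sym (same u))
  placed-mono (block _ _ _ _ _ _ _ _ _ pl) = Equivalence.from (pl _ _) ∘ inj₁
  placed-mono (clique _ _ _ _ _ _ pl)      = Equivalence.from (pl _ _) ∘ inj₁

  -- Only a close can take a pair off the live cables, and its legality condition is exactly that
  -- the vertices it removes are settled.
  together-step : ∀ {c c′ : Config G} → Move c c′ → ∀ {u u′} →
                  Together c u u′ → Together c′ u u′ ⊎ Settled c u
  together-step (birth _ _ _ _ L _) t = inj₁ (Any-resp-↭ (↭-sym L) (there t))
  together-step (fold X Y rest L _ L′ _) {u} {u′} t = inj₁ (Any-resp-↭ (↭-sym L′) (merge (Any-resp-↭ L t)))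
    where
    merge : Any (λ Z → u ∈ Z × u′ ∈ Z) (X ∷ Y ∷ rest) → Any (λ Z → u ∈ Z × u′ ∈ Z) ((X ∪ Y) ∷ rest)
    merge (here (p , q))         = here (x∈p∪q⁺ (inj₁ p) , x∈p∪q⁺ (inj₁ q))
    merge (there (here (p , q))) = here (x∈p∪q⁺ (inj₂ p) , x∈p∪q⁺ (inj₂ q))
    merge (there (there t))      = there t
  together-step (block _ _ _ _ _ _ _ _ L _) t = inj₁ (Any-resp-↭ (↭-sym L) t)
  together-step (clique _ _ _ _ _ L _)      t = inj₁ (Any-resp-↭ (↭-sym L) t)
  together-step (close _ _ L done _ L′ _)   t with Any-resp-↭ L t
  ... | here (u∈X , _) = inj₂ (done u∈X)
  ... | there t′       = inj₁ (Any-resp-↭ (↭-sym L′) t′)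

  born-step : ∀ {c c′ : Config G} → Move c c′ → ∀ {u} → u ∈ born c′ → u ∈ born c ⊎ Together c′ u u
  born-step {c} (birth S _ _ B L _) {u} u∈ with x∈p∪q⁻ S (born c) (subst (u ∈_) B u∈)
  ... | inj₁ u∈S = inj₂ (Any-resp-↭ (↭-sym L) (here (u∈S , u∈S)))
  ... | inj₂ u∈c = inj₁ u∈c
  born-step (fold _ _ _ _ B _ _)        {u} u∈ = inj₁ (subst (u ∈_) B u∈)
  born-step (block _ _ _ _ _ _ _ B _ _) {u} u∈ = inj₁ (subst (u ∈_) B u∈)
  born-step (clique _ _ _ _ B _ _)      {u} u∈ = inj₁ (subst (u ∈_) B u∈)
  born-step (close _ _ _ _ B _ _)       {u} u∈ = inj₁ (subst (u ∈_) B u∈)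

  -- An invariant of the play: a vertex is born onto a live cable, can leave it only by a close, and
  -- stays settled because placed edges are never removed.
  LiveOrSettled : Config G → Set
  LiveOrSettled c = ∀ {u} → u ∈ born c → Together c u u ⊎ Settled c u

  liveOrSettled-step : ∀ {c c′ : Config G} → Move c c′ → LiveOrSettled c → LiveOrSettled c′
  liveOrSettled-step m los u∈ with born-step m u∈
  ... | inj₂ t = inj₁ t
  ... | inj₁ u∈c with los u∈c
  ...   | inj₂ s = inj₂ (placed-mono m ∘ s)
  ...   | inj₁ t with together-step m t
  ...     | inj₁ t′ = inj₁ t′
  ...     | inj₂ s  = inj₂ (placed-mono m ∘ s)

  -- What can be read off a move that places the edge from `u` to `v`, be it a block or a clique. In
  -- `twins` the case `v ≡ u′` is excluded because a clique may have `v` on the same cable as `u`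
  -- and `u′`.
  record NewlyPlaced {c c′ : Config G} (m : Move c c′) (u v : Fin n) : Set where
    field
      cost-even : cost m ≡ 2 * length (live c)
      head-born : v ∈ born c
      twins     : ∀ {u′} → Together c u u′ → v ≢ u′ → v ∈ N u′

  newlyPlaced : ∀ {c c′ : Config G} (m : Move c c′) {u v} →
                v ∈ placed c′ u → v ∉ placed c u → NewlyPlaced m u v
  newlyPlaced (birth _ _ _ _ _ same)   {u} v∈ v∉ = contradiction (subst (_ ∈_) (same u) v∈) v∉
  newlyPlaced (fold _ _ _ _ _ _ same)  {u} v∈ v∉ = contradiction (subst (_ ∈_) (same u) v∈) v∉
  newlyPlaced (close _ _ _ _ _ _ same) {u} v∈ v∉ = contradiction (subst (_ ∈_) (same u) v∈) v∉
  newlyPlaced {c} (block X Y X∈ Y∈ _ edge _ _ _ pl) v∈ v∉ with Equivalence.to (pl _ _) v∈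
  ... | inj₁ v∈c = contradiction v∈c v∉
  ... | inj₂ (inj₁ (u∈X , v∈Y)) = record
    { cost-even = refl
    ; head-born = ∈live⇒∈born c Y∈ v∈Y
    ; twins     = λ t _ → edge (together-∈ c t X∈ u∈X) v∈Y
    }
  ... | inj₂ (inj₂ (u∈Y , v∈X)) = record
    { cost-even = refl
    ; head-born = ∈live⇒∈born c X∈ v∈X
    ; twins     = λ t _ → Graph.sym G (edge v∈X (together-∈ c t Y∈ u∈Y))
    }
  newlyPlaced {c} (clique X X∈ edge _ _ _ pl) v∈ v∉ with Equivalence.to (pl _ _) v∈
  ... | inj₁ v∈c = contradiction v∈c v∉
  ... | inj₂ (u∈X , v∈X , _) = record
    { cost-even = refl
    ; head-born = ∈live⇒∈born c X∈ v∈X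
    ; twins     = λ t v≢u′ → edge (together-∈ c t X∈ u∈X) v∈X (v≢u′ ∘ sym)
    }

  -- Follow the play to the move that places the edge from `u` to `v`. Until then `u` is not
  -- settled, so its cable is not closed and still holds `u′`; that move then forces `v` to be
  -- adjacent to `u′` too.
  together⇒twins : ∀ {c d : Config G} → Star Move c d → (∀ u → N u ⊆ placed d u) →
                   ∀ {u u′ v} → Together c u u′ → v ∈ N u → v ∉ placed c u → v ≢ u′ → v ∈ N u′
  together⇒twins ε full t v∈ v∉ _ = contradiction (full _ v∈) v∉
  together⇒twins (_◅_ {j = c′} m ms) full {u} {u′} {v} t v∈ v∉ v≢u′ with v ∈? placed c′ u
  ... | yes v∈c′ = NewlyPlaced.twins (newlyPlaced m v∈c′ v∉) t v≢u′
  ... | no  v∉c′ with together-step m t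
  ...   | inj₁ t′ = together⇒twins ms full t′ v∈ v∉c′ v≢u′
  ...   | inj₂ s  = contradiction (s v∈) v∉

  born⊎later : ∀ {c d : Config G} (ms : Star Move c d) {v} → v ∈ born d → v ∈ born c ⊎ Any (v ∈_) (birthGroups ms)
  born⊎later ε v∈ = inj₁ v∈
  born⊎later {c} (birth S _ _ B _ _ ◅ ms) {v} v∈ with born⊎later ms v∈
  ... | inj₂ later = inj₂ (there later)
  ... | inj₁ v∈c′ with x∈p∪q⁻ S (born c) (subst (v ∈_) B v∈c′)
  ...   | inj₁ v∈S = inj₂ (here v∈S)
  ...   | inj₂ v∈c = inj₁ v∈c
  born⊎later (fold _ _ _ _ B _ _ ◅ ms)        {v} v∈ = [ inj₁ ∘ subst (v ∈_) B , inj₂ ]′ (born⊎later ms v∈)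
  born⊎later (block _ _ _ _ _ _ _ B _ _ ◅ ms) {v} v∈ = [ inj₁ ∘ subst (v ∈_) B , inj₂ ]′ (born⊎later ms v∈)
  born⊎later (clique _ _ _ _ B _ _ ◅ ms)      {v} v∈ = [ inj₁ ∘ subst (v ∈_) B , inj₂ ]′ (born⊎later ms v∈)
  born⊎later (close _ _ _ _ B _ _ ◅ ms)       {v} v∈ = [ inj₁ ∘ subst (v ∈_) B , inj₂ ]′ (born⊎later ms v∈)

  -- Birth order and the bound at one cut.

  module _ (π : Layout n) where

    -- The vertices already born act as one more group, preceding the later ones.
    BirthOrdered : ∀ {c d : Config G} → Star Move c d → Set
    BirthOrdered {c} ms = AllPairs (Precedes π) (born c ∷ birthGroups ms)

    -- A birth moves the first group of the list into the born set; both of these precede every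
    -- later group, hence so does their union.
    birthOrdered-tail : ∀ {c c′ d : Config G} (m : Move c c′) (ms : Star Move c′ d) →
                        BirthOrdered (m ◅ ms) → BirthOrdered ms
    birthOrdered-tail (birth _ _ _ B _ _) ms ((_ ∷ c<) ∷ S< ∷ rest)
      rewrite B = precedes-∪ π S< c< ∷ rest
    birthOrdered-tail (fold _ _ _ _ B _ _)        ms o rewrite B = o
    birthOrdered-tail (block _ _ _ _ _ _ _ B _ _) ms o rewrite B = o
    birthOrdered-tail (clique _ _ _ _ B _ _)      ms o rewrite B = o
    birthOrdered-tail (close _ _ _ _ B _ _)       ms o rewrite B = o

    born-first : ∀ {c d : Config G} (ms : Star Move c d) → BirthOrdered ms → ∀ {u v} →
                 u ∈ born c → v ∈ born d → v ∉ born c → (π ⟨$⟩ˡ u) Fin.< (π ⟨$⟩ˡ v)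
    born-first ms (c< ∷ _) u∈ v∈ v∉ with born⊎later ms v∈
    ... | inj₁ v∈c   = contradiction v∈c v∉
    ... | inj₂ later with All.lookupAny c< later
    ...   | c<T , v∈T = c<T u∈ v∈T

    ∈P⁺ : ∀ i {u} → toℕ (π ⟨$⟩ˡ u) < i → u ∈ P G π i
    ∈P⁺ i {u} u<i = lookup⇒[]= u _ (trans (lookup∘tabulate _ u) (dec-true (_ <? i) u<i))

    ∈P⁻ : ∀ i {u} → u ∈ P G π i → toℕ (π ⟨$⟩ˡ u) < i
    ∈P⁻ i {u} u∈P = invert (subst (Reflects _)
      (trans (sym (lookup∘tabulate (λ v → does (toℕ (π ⟨$⟩ˡ v) <? i)) u)) ([]=⇒lookup u∈P))
      (proof (toℕ (π ⟨$⟩ˡ u) <? i)))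

    Crossing : ℕ → Config G → Fin n → Fin n → Set
    Crossing i c u v = u ∈ P G π i × v ∉ P G π i × v ∈ placed c u

    NoCrossing : ℕ → Config G → Set
    NoCrossing i c = ∀ {u v} → ¬ Crossing i c u v

    ∈𝒜⁻ : ∀ i {A} → A List.∈ 𝒜 G π i → Nonempty A × ∃ λ u → u ∈ P G π i × A ≡ r G π i u
    ∈𝒜⁻ i A∈ with ∈-filter⁻ nonempty? {xs = map (r G π i) (filter (_∈? P G π i) (allFin n))}
                    (∈-deduplicate⁻ (≡-dec _≟ᵇ_) _ A∈)
    ... | A∈map , A≢∅ with ∈-map⁻ (r G π i) A∈map
    ...   | u , u∈ , eq = A≢∅ , u , proj₂ (∈-filter⁻ (_∈? P G π i) {xs = allFin n} u∈) , eq

    -- Each active neighbourhood is charged to a live cable that holds a vertex of the cut realising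
    -- it, and no cable is charged twice.
    length-𝒜≤length-live : ∀ i {c d : Config G} → Star Move c d → (∀ u → N u ⊆ placed d u) →
                           P G π i ⊆ born c → LiveOrSettled c → NoCrossing i c →
                           length (𝒜 G π i) ≤ length (live c)
    length-𝒜≤length-live i {c} ms full P⊆born los none =
      Unique⇒length≤ R (deduplicate-! (≡-dec _≟ᵇ_) _) cover R-inj
      where
      -- Liveness of `X` is part of the relation so that `R-inj` can turn two vertices of `X` into
      -- an instance of `Together`.
      R : Subset n → Subset n → Set
      R A X = X List.∈ live c × ∃ λ u → u ∈ P G π i × u ∈ X × A ≡ r G π i u

      cover : ∀ {A} → A List.∈ 𝒜 G π i → Any (R A) (live c)
      cover A∈ with ∈𝒜⁻ i A∈
      ... | (v , v∈A) , u , u∈P , refl with x∈p∩q⁻ (N u) (∁ (P G π i)) v∈A | los (P⊆born u∈P)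
      -- A settled `u` would already have its edge to `v` placed, and that edge crosses the cut.
      ...   | v∈N , v∈∁ | inj₂ s = ⊥-elim (none (u∈P , x∈∁p⇒x∉p v∈∁ , s v∈N))
      ...   | _         | inj₁ t with List.find t
      ...     | X , X∈ , u∈X , _ = List.lose X∈ (X∈ , u , u∈P , u∈X , refl)

      r-⊆ : ∀ {u u′} → u ∈ P G π i → u′ ∈ P G π i → Together c u u′ → r G π i u ⊆ r G π i u′
      r-⊆ {u} u∈P u′∈P t v∈ with x∈p∩q⁻ (N u) (∁ (P G π i)) v∈
      ... | v∈N , v∈∁ = x∈p∩q⁺
        (together⇒twins ms full t v∈N (λ v∈c → none (u∈P , x∈∁p⇒x∉p v∈∁ , v∈c))
                        (λ { refl → x∈∁p⇒x∉p v∈∁ u′∈P }) , v∈∁)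

      R-inj : ∀ {A B X} → R A X → R B X → A ≡ B
      R-inj (X∈ , u , u∈P , u∈X , refl) (_ , u′ , u′∈P , u′∈X , refl) = ⊆-antisym
        (r-⊆ u∈P u′∈P (List.lose X∈ (u∈X , u′∈X)))
        (r-⊆ u′∈P u∈P (List.lose X∈ (u′∈X , u∈X)))

    -- Induction along the play, with `NoCrossing` as the invariant up to the first move that places
    -- a crossing edge. If there is none, the final configuration has no live cable and the count is
    -- 0.
    length-𝒜≤ : ∀ i {c d : Config G} (ms : Star Move c d) →
                born d ≡ ⊤ → (∀ u → N u ⊆ placed d u) → live d ≡ [] →
                BirthOrdered ms → LiveOrSettled c → NoCrossing i c →
                length (𝒜 G π i) ≤ ⌊ maximum (costs ms) /2⌋
    length-𝒜≤ i {c} ε all-born full closed _ los none = ≤-trans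
      (length-𝒜≤length-live i {c} ε full (λ {u} _ → subst (u ∈_) (sym all-born) ∈⊤) los none)
      (≤-reflexive (cong length closed))
    length-𝒜≤ i {c} (_◅_ {j = c′} m ms) all-born full closed ordered los none
      with any? (λ u → any? (λ v → (u ∈? P G π i) ×-dec ¬? (v ∈? P G π i) ×-dec (v ∈? placed c′ u)))
    ... | no none′ = ≤-trans
      (length-𝒜≤ i ms all-born full closed (birthOrdered-tail m ms ordered)
                 (liveOrSettled-step m los) (λ x → none′ (_ , _ , x)))
      (⌊n/2⌋-mono (m≤n⊔m (cost m) _))
    ... | yes (u , v , u∈P , v∉P , v∈c′) = ≤-trans
      (length-𝒜≤length-live i (m ◅ ms) full P⊆born los none)
      (≤-trans (≤-reflexive ℓ≡) (⌊n/2⌋-mono (m≤m⊔n (cost m) _)))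
      where
      open NewlyPlaced (newlyPlaced m v∈c′ (λ v∈c → none (u∈P , v∉P , v∈c)))

      -- If `x` were unborn, the born vertex `v` would come before it in the layout, and so `v`
      -- would lie inside the cut as well.
      P⊆born : P G π i ⊆ born c
      P⊆born {x} x∈P = decidable-stable (x ∈? born c) λ x∉c → v∉P (∈P⁺ i (<-trans
        (born-first (m ◅ ms) ordered head-born (subst (x ∈_) (sym all-born) ∈⊤) x∉c) (∈P⁻ i x∈P)))

      -- The cost is `2 * length (live c)`, which unfolds to a sum ending in `+ 0`; halving it loses
      -- nothing.
      ℓ≡ : length (live c) ≡ ⌊ cost m /2⌋
      ℓ≡ = trans (n≡⌊n+n/2⌋ _)
                 (cong ⌊_/2⌋ (trans (cong (length (live c) +_) (sym (+-identityʳ _))) (sym cost-even)))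

proposition3p4 : ∀ {n : ℕ} (G : Graph n) (p : Play G) (w : ℕ) → Constructs p → width p ≡ w →
    (π : Layout n) → IsBirthOrder p π → anw G π ≤ ⌊ w /2⌋
proposition3p4 {n} G p w constructs refl π ordered = maximum-lub (All.map⁺ (All.universal cut (allFin _)))
  where
  open Constructs constructs

  cut : (i : Fin (ℕ.suc n)) → length (𝒜 G π (toℕ i)) ≤ ⌊ width p /2⌋
  cut i = length-𝒜≤ π (toℕ i) (Play.moves p) all-born all-placed all-closed
    -- Nothing is born or placed initially, so the empty born set precedes every group and both
    -- invariants hold vacuously.
    (All.universal (precedes-⊥ π) _ ∷ ordered)
    (λ u∈⊥ → ⊥-elim (∉⊥ u∈⊥))
    (λ (_ , _ , v∈⊥) → ∉⊥ v∈⊥)
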